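{- If $n$ is a positive integer and $p$ is a non-zero integer, then $$\sum_{k=0}^n(-1)^{n-k}\frac{n}{n+k}\binom{n+k}{n-k}\left(\frac{2L_{2p}}{\sqrt5F_{2p}}\right)^{2k}=\frac12\left(\Bigl(\frac{\sqrt5F_p}{L_p}\Bigr)^{2n}+\Bigl(\frac{L_p}{\sqrt5F_p}\Bigr)^{2n}\right).$$
   Context: $F_n$ and $L_n$ ($n\in\mathbb{Z}$) are the Fibonacci and Lucas numbers: $F_0=0$, $F_1=1$, $F_n=F_{n-1}+F_{n-2}$; $L_0=2$, $L_1=1$, $L_n=L_{n-1}+L_{n-2}$, extended to negative indices by $F_{ -n}=(-1)^{n-1}F_n$, $L_{ -n}=(-1)^nL_n$. -}

module Defs where

open import Algebra.Bundles.Raw using (RawSemiring)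
open import Data.Fin.Base using (toℕ)
open import Data.Integer.Base as ℤ using (ℤ; +_; -[1+_]; -1ℤ; 0ℤ)
import Data.Integer.Properties as ℤ
open import Data.Nat.Base as ℕ using (ℕ; zero; suc)
import Data.Nat.Properties as ℕ
open import Data.Rational.Base as ℚ using (ℚ; 0ℚ; 1ℚ)
import Data.Rational.Properties as ℚ
open import Data.Rational.Solver using (module +-*-Solver)
import Data.Rational.Unnormalised.Base as ℚᵘ
import Data.Rational.Unnormalised.Properties as ℚᵘ
open import Function.Base using (_∘_)
open import Level using (0ℓ)
open import Relation.Binary.PropositionalEquality

------------------------------------------------------------------------
-- Fibonacci and Lucas numbers

fib : ℕ → ℕ
fib 0             = 0
fib 1             = 1
fib (suc (suc n)) = fib (suc n) ℕ.+ fib n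

lucas : ℕ → ℕ
lucas 0             = 2
lucas 1             = 1
lucas (suc (suc n)) = lucas (suc n) ℕ.+ lucas n

-- -[1+ n ] is -(n + 1), so the signs are (-1)^((n + 1) - 1) and (-1)^(n + 1).

F : ℤ → ℤ
F (+ n)    = + fib n
F -[1+ n ] = -1ℤ ℤ.^ n ℤ.* + fib (suc n)

L : ℤ → ℤ
L (+ n)    = + lucas n
L -[1+ n ] = -1ℤ ℤ.^ suc n ℤ.* + lucas (suc n)

------------------------------------------------------------------------
-- The field ℚ(√5); a +√5 b stands for a + b√5

infix 5 _+√5_

record ℚ[√5] : Set where
  constructor _+√5_
  field
    re im : ℚ

open ℚ[√5] public

5ℚ : ℚ
5ℚ = + 5 ℚ./ 1

fromℚ : ℚ → ℚ[√5]
fromℚ q = q +√5 0ℚ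

fromℤ : ℤ → ℚ[√5]
fromℤ i = fromℚ (i ℚ./ 1)

fromℕ : ℕ → ℚ[√5]
fromℕ n = fromℤ (+ n)

√5 : ℚ[√5]
√5 = 0ℚ +√5 1ℚ

infix  8 -_ _⁻¹
infixl 7 _*_ _÷_
infixl 6 _+_

_+_ : ℚ[√5] → ℚ[√5] → ℚ[√5]
(a +√5 b) + (c +√5 d) = a ℚ.+ c +√5 b ℚ.+ d

-_ : ℚ[√5] → ℚ[√5]
- (a +√5 b) = ℚ.- a +√5 ℚ.- b

_*_ : ℚ[√5] → ℚ[√5] → ℚ[√5]
(a +√5 b) * (c +√5 d) = a ℚ.* c ℚ.+ 5ℚ ℚ.* (b ℚ.* d) +√5 a ℚ.* d ℚ.+ b ℚ.* c

rawSemiring : RawSemiring 0ℓ 0ℓ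
rawSemiring = record
  { Carrier = ℚ[√5]
  ; _≈_     = _≡_
  ; _+_     = _+_
  ; _*_     = _*_
  ; 0#      = fromℚ 0ℚ
  ; 1#      = fromℚ 1ℚ
  }

open import Algebra.Definitions.RawSemiring rawSemiring public using (_^_; sum)

-- The range 0 ≤ k ≤ n includes both endpoints.

∑≤ : ℕ → (ℕ → ℚ[√5]) → ℚ[√5]
∑≤ n f = sum {suc n} (f ∘ toℕ)

infix 5 ∑≤
syntax ∑≤ n (λ k → x) = ∑[ k ≤ n ] x

norm : ℚ[√5] → ℚ
norm (a +√5 b) = a ℚ.* a ℚ.- 5ℚ ℚ.* (b ℚ.* b)

-- As 5 is not a square in ℚ, the norm of x vanishes only when x does.

record NonZero (x : ℚ[√5]) : Set where
  field
    norm≢0 : norm x ≢ 0ℚ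

_⁻¹ : (x : ℚ[√5]) → .{{NonZero x}} → ℚ[√5]
(x ⁻¹) {{x≢0}} = re x ℚ.* r +√5 ℚ.- (im x) ℚ.* r
  where r = (ℚ.1/ norm x) {{ℚ.≢-nonZero (NonZero.norm≢0 x≢0)}}

_÷_ : (x y : ℚ[√5]) → .{{NonZero y}} → ℚ[√5]
x ÷ y = x * y ⁻¹

√5*√5≡5 : √5 * √5 ≡ fromℕ 5
√5*√5≡5 = refl

*-inverseʳ : ∀ x .{{_ : NonZero x}} → x * x ⁻¹ ≡ fromℚ 1ℚ
*-inverseʳ (a +√5 b) {{x≢0}} = cong₂ _+√5_
  (trans (solve 4 (λ a b c r →
            a :* (a :* r) :+ c :* (b :* (:- b :* r)) :=
            (a :* a :+ :- (c :* (b :* b))) :* r) refl a b 5ℚ r)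
         (ℚ.*-inverseʳ (norm (a +√5 b)) {{ℚ.≢-nonZero (NonZero.norm≢0 x≢0)}}))
  (solve 3 (λ a b r → a :* (:- b :* r) :+ b :* (a :* r) := con 0ℚ) refl a b r)
  where
  open +-*-Solver
  r = (ℚ.1/ norm (a +√5 b)) {{ℚ.≢-nonZero (NonZero.norm≢0 x≢0)}}

------------------------------------------------------------------------
-- The denominators do not vanish

fib>0 : ∀ n → fib (suc n) ℕ.> 0
fib>0 zero    = ℕ.z<s
fib>0 (suc n) = ℕ.<-≤-trans (fib>0 n) (ℕ.m≤m+n _ _)

lucas>0 : ∀ n → lucas n ℕ.> 0
lucas>0 0             = ℕ.z<s
lucas>0 1             = ℕ.z<s
lucas>0 (suc (suc n)) = ℕ.<-≤-trans (lucas>0 (suc n)) (ℕ.m≤m+n _ _)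

sign≢0 : ∀ n → ℤ.NonZero (-1ℤ ℤ.^ n)
sign≢0 zero    = _
sign≢0 (suc n) = ℤ.i*j≢0 -1ℤ (-1ℤ ℤ.^ n) {{_}} {{sign≢0 n}}

F≢0 : ∀ p .{{_ : ℤ.NonZero p}} → ℤ.NonZero (F p)
F≢0 (+ suc n) = ℕ.>-nonZero (fib>0 n)
F≢0 -[1+ n ]  = ℤ.i*j≢0 (-1ℤ ℤ.^ n) (+ fib (suc n))
                  {{sign≢0 n}} {{ℕ.>-nonZero (fib>0 n)}}

L≢0 : ∀ p → ℤ.NonZero (L p)
L≢0 (+ n)    = ℕ.>-nonZero (lucas>0 n)
L≢0 -[1+ n ] = ℤ.i*j≢0 (-1ℤ ℤ.^ suc n) (+ lucas (suc n))
                 {{sign≢0 (suc n)}} {{ℕ.>-nonZero (lucas>0 (suc n))}}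

private
  p*q≢0 : ∀ {p q} → p ≢ 0ℚ → q ≢ 0ℚ → p ℚ.* q ≢ 0ℚ
  p*q≢0 {p} {q} p≢0 q≢0 pq≡0 = q≢0 (begin
    q                     ≡⟨ ℚ.*-identityˡ q ⟨
    1ℚ ℚ.* q              ≡⟨ cong (ℚ._* q) (ℚ.*-inverseˡ p) ⟨
    ℚ.1/ p ℚ.* p ℚ.* q    ≡⟨ ℚ.*-assoc (ℚ.1/ p) p q ⟩
    ℚ.1/ p ℚ.* (p ℚ.* q)  ≡⟨ cong (ℚ.1/ p ℚ.*_) pq≡0 ⟩
    ℚ.1/ p ℚ.* 0ℚ         ≡⟨ ℚ.*-zeroʳ (ℚ.1/ p) ⟩
    0ℚ                    ∎)
    where
    open ≡-Reasoning
    instance _ = ℚ.≢-nonZero p≢0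

  i/1≢0 : ∀ i .{{_ : ℤ.NonZero i}} → i ℚ./ 1 ≢ 0ℚ
  i/1≢0 i i/1≡0 = ℕ.≢-nonZero⁻¹ ℤ.∣ i ∣ (cong ℤ.∣_∣ (begin
    i            ≡⟨ ℤ.*-identityʳ i ⟨
    i ℤ.* + 1    ≡⟨ ℚᵘ.drop-*≡* (ℚᵘ.≃-trans
                      (ℚᵘ.≃-sym (ℚ.toℚᵘ-fromℚᵘ (ℚᵘ.mkℚᵘ i 0)))
                      (ℚᵘ.≃-reflexive (cong ℚ.toℚᵘ i/1≡0))) ⟩
    0ℤ           ∎))
    where open ≡-Reasoning

fromℤ≢0 : ∀ i .{{_ : ℤ.NonZero i}} → NonZero (fromℤ i)
fromℤ≢0 i .NonZero.norm≢0 eq =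
  p*q≢0 (i/1≢0 i) (i/1≢0 i)
    (trans (solve 1 (λ q → q :* q := q :* q :+ :- (con 5ℚ :* (con 0ℚ :* con 0ℚ)))
              refl (i ℚ./ 1)) eq)
  where open +-*-Solver

√5*fromℤ≢0 : ∀ i .{{_ : ℤ.NonZero i}} → NonZero (√5 * fromℤ i)
√5*fromℤ≢0 i .NonZero.norm≢0 eq =
  p*q≢0 { ℚ.- 5ℚ } (λ ()) (p*q≢0 (i/1≢0 i) (i/1≢0 i))
    (trans (solve 1 (λ q →
              con (ℚ.- 5ℚ) :* (q :* q) :=
              (con 0ℚ :* q :+ con 5ℚ :* (con 1ℚ :* con 0ℚ)) :*
              (con 0ℚ :* q :+ con 5ℚ :* (con 1ℚ :* con 0ℚ)) :+
              :- (con 5ℚ :* ((con 0ℚ :* con 0ℚ :+ con 1ℚ :* q) :*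
                             (con 0ℚ :* con 0ℚ :+ con 1ℚ :* q))))
              refl (i ℚ./ 1)) eq)
  where open +-*-Solver

instance
  m+n≢0 : ∀ {m n} .{{_ : ℕ.NonZero m}} → ℕ.NonZero (m ℕ.+ n)
  m+n≢0 {m} = ℕ.>-nonZero (ℕ.<-≤-trans (ℕ.>-nonZero⁻¹ m) (ℕ.m≤m+n _ _))

L-nonZero : ∀ p → NonZero (fromℤ (L p))
L-nonZero p = fromℤ≢0 (L p) {{L≢0 p}}

√5F-nonZero : ∀ p .{{_ : ℤ.NonZero p}} → NonZero (√5 * fromℤ (F p))
√5F-nonZero p = √5*fromℤ≢0 (F p) {{F≢0 p}}

√5F2-nonZero : ∀ p .{{_ : ℤ.NonZero p}} → NonZero (√5 * fromℤ (F (+ 2 ℤ.* p)))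
√5F2-nonZero p = √5F-nonZero (+ 2 ℤ.* p) {{ℤ.i*j≢0 (+ 2) p}}

{-# OPTIONS --safe #-}
module Submission where

-- Put u = √5F_p/L_p and v = 1/u. Since F_2p = F_p L_p and 2L_2p = 5F_p² + L_p²,
-- the base on the left-hand side is u + v. The coefficient 2n/(n+k) C(n+k, n−k)
-- equals C(n+k, 2k) + C(n+k−1, 2k), so with z = −(u+v)² the left-hand side is
-- (−1)ⁿ/2 · (eₙ + eₙ₋₁), where eₙ = Σ C(n+k, 2k) zᵏ. Pascal's rule, applied
-- to eₙ and oₙ = Σ C(n+k+1, 2k+1) zᵏ, gives eₙ₊₁ = eₙ + z oₙ and
-- oₙ₊₁ = oₙ + eₙ₊₁, hence eₙ₊₂ + eₙ = (z+2) eₙ₊₁. As z + 2 = p + q for p = −u²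
-- and q = −v², whose product is 1, eₙ + eₙ₋₁ satisfies the recurrence of pⁿ + qⁿ.

open import Algebra.Bundles using (CommutativeRing)
import Algebra.Properties.CommutativeSemiring.Exp as Exp
import Algebra.Properties.Group as Group
import Algebra.Properties.Monoid.Mult as Mult
import Algebra.Properties.Ring as Ring
import Algebra.Properties.Semiring.Exp as SemiringExp
import Algebra.Properties.Semiring.Mult as SemiringMult
import Algebra.Properties.Semiring.Sum as Sum
import Algebra.Solver.Ring.NaturalCoefficients.Default as NaturalSolver
open import Algebra.Structures using (IsCommutativeRing)
open import Data.Fin.Base using (toℕ)
import Data.Fin.Properties as Fin
open import Data.Integer.Base as ℤ using (ℤ; +_; -[1+_]; -1ℤ)
import Data.Integer.Properties as ℤ
import Data.Integer.Tactic.RingSolver as ℤSolver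
open import Data.Nat.Base as ℕ using (ℕ; zero; suc; _∸_)
open import Data.Nat.Combinatorics using (_C_; nC1≡n; nCk≡nC[n∸k]; nCk+nC[k+1]≡[n+1]C[k+1]; k>n⇒nCk≡0)
import Data.Nat.Properties as ℕ
import Data.Nat.Tactic.RingSolver as ℕSolver
open import Data.Product.Base using (_,_)
open import Data.Rational.Base as ℚ using (0ℚ; 1ℚ; ½)
import Data.Rational.Properties as ℚ
open import Data.Rational.Solver using (module +-*-Solver)
open import Data.Rational.Unnormalised.Base as ℚᵘ using (mkℚᵘ; *≡*)
import Data.Rational.Unnormalised.Properties as ℚᵘ
open import Defs using (fib; lucas; F; L)
open import Function.Base using (_∘_)
open import Level using (0ℓ)
open import Relation.Binary.PropositionalEquality as ≡ using (_≡_; refl; sym; trans; cong; cong₂; subst)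

-- Binomial coefficients

n*2≡n+n : ∀ n → n ℕ.* 2 ≡ n ℕ.+ n
n*2≡n+n n = trans (ℕ.*-comm n 2) (cong (n ℕ.+_) (ℕ.+-identityʳ n))

m<n⇒m+n<n*2 : ∀ {m n} → m ℕ.< n → m ℕ.+ n ℕ.< n ℕ.* 2
m<n⇒m+n<n*2 {m} {n} m<n = subst (m ℕ.+ n ℕ.<_) (sym (n*2≡n+n n)) (ℕ.+-monoˡ-< n m<n)

-- Absorption, by induction on `n` without factorials: Pascal's rule splits the left binomial, the
-- hypothesis is applied at `k` and at `suc k`, and Pascal's rule puts the results together again.
[k+1]*[n+1]C[k+1]≡[n+1]*nCk : ∀ n k → suc k ℕ.* (suc n C suc k) ≡ suc n ℕ.* (n C k)
[k+1]*[n+1]C[k+1]≡[n+1]*nCk zero    zero    = refl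
[k+1]*[n+1]C[k+1]≡[n+1]*nCk zero    (suc k) = ℕ.*-zeroʳ (suc (suc k))
[k+1]*[n+1]C[k+1]≡[n+1]*nCk (suc n) zero    = begin
  1 ℕ.* (suc (suc n) C 1)  ≡⟨ ℕ.*-identityˡ _ ⟩
  suc (suc n) C 1          ≡⟨ nC1≡n (suc (suc n)) ⟩
  suc (suc n)              ≡⟨ ℕ.*-identityʳ _ ⟨
  suc (suc n) ℕ.* 1        ∎
  where open ≡.≡-Reasoning
[k+1]*[n+1]C[k+1]≡[n+1]*nCk (suc n) (suc k) = begin
  suc (suc k) ℕ.* (suc (suc n) C suc (suc k))
    ≡⟨ cong (suc (suc k) ℕ.*_) (nCk+nC[k+1]≡[n+1]C[k+1] (suc n) (suc k)) ⟨
  suc (suc k) ℕ.* (c ℕ.+ (suc n C suc (suc k)))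
    ≡⟨ ℕ.*-distribˡ-+ (suc (suc k)) c _ ⟩
  c ℕ.+ suc k ℕ.* c ℕ.+ suc (suc k) ℕ.* (suc n C suc (suc k))
    ≡⟨ cong₂ (λ x y → c ℕ.+ x ℕ.+ y)
         ([k+1]*[n+1]C[k+1]≡[n+1]*nCk n k) ([k+1]*[n+1]C[k+1]≡[n+1]*nCk n (suc k)) ⟩
  c ℕ.+ suc n ℕ.* (n C k) ℕ.+ suc n ℕ.* (n C suc k)
    ≡⟨ ℕ.+-assoc c _ _ ⟩
  c ℕ.+ (suc n ℕ.* (n C k) ℕ.+ suc n ℕ.* (n C suc k))
    ≡⟨ cong (c ℕ.+_) (ℕ.*-distribˡ-+ (suc n) (n C k) (n C suc k)) ⟨
  c ℕ.+ suc n ℕ.* ((n C k) ℕ.+ (n C suc k))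
    ≡⟨ cong (λ x → c ℕ.+ suc n ℕ.* x) (nCk+nC[k+1]≡[n+1]C[k+1] n k) ⟩
  suc (suc n) ℕ.* c ∎
  where
  open ≡.≡-Reasoning
  c = suc n C suc k

-- The second summand stays on the left to avoid the truncated difference n + 1 ∸ k. For positive k,
-- absorption turns it into (n+1) C(n, k-1), and Pascal's rule finishes.
[n+1]*nCk+k*[n+1]Ck≡[n+1]*[n+1]Ck : ∀ n k →
  suc n ℕ.* (n C k) ℕ.+ k ℕ.* (suc n C k) ≡ suc n ℕ.* (suc n C k)
[n+1]*nCk+k*[n+1]Ck≡[n+1]*[n+1]Ck n zero    = ℕ.+-identityʳ _
[n+1]*nCk+k*[n+1]Ck≡[n+1]*[n+1]Ck n (suc k) = begin
  suc n ℕ.* (n C suc k) ℕ.+ suc k ℕ.* (suc n C suc k)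
    ≡⟨ cong (suc n ℕ.* (n C suc k) ℕ.+_) ([k+1]*[n+1]C[k+1]≡[n+1]*nCk n k) ⟩
  suc n ℕ.* (n C suc k) ℕ.+ suc n ℕ.* (n C k)
    ≡⟨ ℕ.*-distribˡ-+ (suc n) (n C suc k) (n C k) ⟨
  suc n ℕ.* ((n C suc k) ℕ.+ (n C k))
    ≡⟨ cong (suc n ℕ.*_) (ℕ.+-comm (n C suc k) (n C k)) ⟩
  suc n ℕ.* ((n C k) ℕ.+ (n C suc k))
    ≡⟨ cong (suc n ℕ.*_) (nCk+nC[k+1]≡[n+1]C[k+1] n k) ⟩
  suc n ℕ.* (suc n C suc k) ∎
  where open ≡.≡-Reasoning

-- The integer 2n/(n+k) · C(n+k, n−k), for n = m + 1.
coeff : ℕ → ℕ → ℕ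
coeff m k = (suc m ℕ.+ k) C (k ℕ.* 2) ℕ.+ (m ℕ.+ k) C (k ℕ.* 2)

-- Let n = m + 1, and let `c` and `d` be the two binomials in `coeff`. Adding 2kc makes the left
-- side 2(n+k)c; the previous lemma then replaces one of the two copies of (n+k)c by (n+k)d + 2kc.
coeff-spec : ∀ m k → k ℕ.≤ suc m →
  suc m ℕ.* ((suc m ℕ.+ k) C (suc m ∸ k)) ℕ.* 2 ≡ coeff m k ℕ.* (suc m ℕ.+ k)
coeff-spec m k k≤n = ℕ.+-cancelʳ-≡ (k ℕ.* 2 ℕ.* c) _ _ (begin
  suc m ℕ.* ((suc m ℕ.+ k) C (suc m ∸ k)) ℕ.* 2 ℕ.+ k ℕ.* 2 ℕ.* c
    ≡⟨ cong (λ x → suc m ℕ.* x ℕ.* 2 ℕ.+ k ℕ.* 2 ℕ.* c) symmetric ⟩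
  suc m ℕ.* c ℕ.* 2 ℕ.+ k ℕ.* 2 ℕ.* c
    ≡⟨ rearrange₁ m k c ⟩
  c ℕ.* (suc m ℕ.+ k) ℕ.+ (suc m ℕ.+ k) ℕ.* c
    ≡⟨ cong (c ℕ.* (suc m ℕ.+ k) ℕ.+_)
         ([n+1]*nCk+k*[n+1]Ck≡[n+1]*[n+1]Ck (m ℕ.+ k) (k ℕ.* 2)) ⟨
  c ℕ.* (suc m ℕ.+ k) ℕ.+ ((suc m ℕ.+ k) ℕ.* d ℕ.+ k ℕ.* 2 ℕ.* c)
    ≡⟨ rearrange₂ m k c d ⟩
  (c ℕ.+ d) ℕ.* (suc m ℕ.+ k) ℕ.+ k ℕ.* 2 ℕ.* c ∎)
  where
  open ≡.≡-Reasoning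
  c = (suc m ℕ.+ k) C (k ℕ.* 2)
  d = (m ℕ.+ k) C (k ℕ.* 2)

  k*2≤n+k : k ℕ.* 2 ℕ.≤ suc m ℕ.+ k
  k*2≤n+k = subst (ℕ._≤ suc m ℕ.+ k) (sym (n*2≡n+n k)) (ℕ.+-monoˡ-≤ k k≤n)

  symmetric : (suc m ℕ.+ k) C (suc m ∸ k) ≡ c
  symmetric = sym (trans (nCk≡nC[n∸k] k*2≤n+k) (cong ((suc m ℕ.+ k) C_)
    (trans (cong (suc m ℕ.+ k ∸_) (n*2≡n+n k))
      (trans (sym (ℕ.∸-+-assoc (suc m ℕ.+ k) k k)) (cong (_∸ k) (ℕ.m+n∸n≡m (suc m) k))))))

  rearrange₁ : ∀ m k c → suc m ℕ.* c ℕ.* 2 ℕ.+ k ℕ.* 2 ℕ.* c ≡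
                         c ℕ.* (suc m ℕ.+ k) ℕ.+ (suc m ℕ.+ k) ℕ.* c
  rearrange₁ = ℕSolver.solve-∀

  rearrange₂ : ∀ m k c d → c ℕ.* (suc m ℕ.+ k) ℕ.+ ((suc m ℕ.+ k) ℕ.* d ℕ.+ k ℕ.* 2 ℕ.* c) ≡
                           (c ℕ.+ d) ℕ.* (suc m ℕ.+ k) ℕ.+ k ℕ.* 2 ℕ.* c
  rearrange₂ = ℕSolver.solve-∀

-- Addition and doubling formulas for Fibonacci and Lucas numbers

-- Induction on `m` for all `n` at once: each step moves one unit from `m` to `n`.
fib-+ : ∀ m n → fib (suc (m ℕ.+ n)) ≡ fib (suc m) ℕ.* fib (suc n) ℕ.+ fib m ℕ.* fib n
fib-+ zero    n = sym (trans (ℕ.+-identityʳ _) (ℕ.*-identityˡ _))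
fib-+ (suc m) n = begin
  fib (suc (suc m ℕ.+ n))
    ≡⟨ cong (fib ∘ suc) (ℕ.+-suc m n) ⟨
  fib (suc (m ℕ.+ suc n))
    ≡⟨ fib-+ m (suc n) ⟩
  fib (suc m) ℕ.* (fib (suc n) ℕ.+ fib n) ℕ.+ fib m ℕ.* fib (suc n)
    ≡⟨ rearrange (fib m) (fib (suc m)) (fib n) (fib (suc n)) ⟩
  (fib (suc m) ℕ.+ fib m) ℕ.* fib (suc n) ℕ.+ fib (suc m) ℕ.* fib n ∎
  where
  open ≡.≡-Reasoning
  rearrange : ∀ a b c d → b ℕ.* (d ℕ.+ c) ℕ.+ a ℕ.* d ≡ (b ℕ.+ a) ℕ.* d ℕ.+ b ℕ.* c
  rearrange = ℕSolver.solve-∀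

-- Both sides satisfy the Fibonacci recurrence and agree at the first two indices.
lucas-fib : ∀ n → lucas (suc n) ≡ fib n ℕ.+ fib (suc (suc n))
lucas-fib zero          = refl
lucas-fib (suc zero)    = refl
lucas-fib (suc (suc n)) = begin
  lucas (suc (suc n)) ℕ.+ lucas (suc n)
    ≡⟨ cong₂ ℕ._+_ (lucas-fib (suc n)) (lucas-fib n) ⟩
  (b ℕ.+ (b ℕ.+ a ℕ.+ b)) ℕ.+ (a ℕ.+ (b ℕ.+ a))
    ≡⟨ rearrange a b ⟩
  (b ℕ.+ a) ℕ.+ (b ℕ.+ a ℕ.+ b ℕ.+ (b ℕ.+ a)) ∎
  where
  open ≡.≡-Reasoning
  a = fib n
  b = fib (suc n)
  rearrange : ∀ a b → (b ℕ.+ (b ℕ.+ a ℕ.+ b)) ℕ.+ (a ℕ.+ (b ℕ.+ a)) ≡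
                      (b ℕ.+ a) ℕ.+ (b ℕ.+ a ℕ.+ b ℕ.+ (b ℕ.+ a))
  rearrange = ℕSolver.solve-∀

fib-double : ∀ n → fib (2 ℕ.* suc n) ≡ fib (suc n) ℕ.* lucas (suc n)
fib-double n = begin
  fib (suc (n ℕ.+ (suc n ℕ.+ 0)))
    ≡⟨ cong (λ x → fib (suc (n ℕ.+ x))) (ℕ.+-identityʳ (suc n)) ⟩
  fib (suc (n ℕ.+ suc n))
    ≡⟨ fib-+ n (suc n) ⟩
  b ℕ.* (b ℕ.+ a) ℕ.+ a ℕ.* b
    ≡⟨ rearrange a b ⟩
  b ℕ.* (a ℕ.+ (b ℕ.+ a))
    ≡⟨ cong (b ℕ.*_) (lucas-fib n) ⟨
  b ℕ.* lucas (suc n) ∎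
  where
  open ≡.≡-Reasoning
  a = fib n
  b = fib (suc n)
  rearrange : ∀ a b → b ℕ.* (b ℕ.+ a) ℕ.+ a ℕ.* b ≡ b ℕ.* (a ℕ.+ (b ℕ.+ a))
  rearrange = ℕSolver.solve-∀

-- By `lucas-fib`, the doubled Lucas number is the sum of the Fibonacci numbers at 2n+1 and 2n+3. By
-- `fib-+` each of these is a sum of two squares, which leaves a polynomial identity in `fib n` and
-- `fib (suc n)`.
lucas-double : ∀ n → 2 ℕ.* lucas (2 ℕ.* suc n) ≡
  5 ℕ.* (fib (suc n) ℕ.* fib (suc n)) ℕ.+ lucas (suc n) ℕ.* lucas (suc n)
lucas-double n = begin
  2 ℕ.* lucas (suc (n ℕ.+ (suc n ℕ.+ 0)))
    ≡⟨ cong (λ x → 2 ℕ.* lucas (suc (n ℕ.+ x))) (ℕ.+-identityʳ (suc n)) ⟩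
  2 ℕ.* lucas (suc (n ℕ.+ suc n))
    ≡⟨ cong (2 ℕ.*_) (lucas-fib (n ℕ.+ suc n)) ⟩
  2 ℕ.* (fib (n ℕ.+ suc n) ℕ.+ fib (suc (suc n ℕ.+ suc n)))
    ≡⟨ cong (λ x → 2 ℕ.* (fib x ℕ.+ fib (suc (suc n ℕ.+ suc n)))) (ℕ.+-suc n n) ⟩
  2 ℕ.* (fib (suc (n ℕ.+ n)) ℕ.+ fib (suc (suc n ℕ.+ suc n)))
    ≡⟨ cong₂ (λ x y → 2 ℕ.* (x ℕ.+ y)) (fib-+ n n) (fib-+ (suc n) (suc n)) ⟩
  2 ℕ.* ((b ℕ.* b ℕ.+ a ℕ.* a) ℕ.+ ((b ℕ.+ a) ℕ.* (b ℕ.+ a) ℕ.+ b ℕ.* b))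
    ≡⟨ rearrange a b ⟩
  5 ℕ.* (b ℕ.* b) ℕ.+ (a ℕ.+ (b ℕ.+ a)) ℕ.* (a ℕ.+ (b ℕ.+ a))
    ≡⟨ cong (λ x → 5 ℕ.* (b ℕ.* b) ℕ.+ x ℕ.* x) (lucas-fib n) ⟨
  5 ℕ.* (b ℕ.* b) ℕ.+ lucas (suc n) ℕ.* lucas (suc n) ∎
  where
  open ≡.≡-Reasoning
  a = fib n
  b = fib (suc n)
  rearrange : ∀ a b →
    2 ℕ.* ((b ℕ.* b ℕ.+ a ℕ.* a) ℕ.+ ((b ℕ.+ a) ℕ.* (b ℕ.+ a) ℕ.+ b ℕ.* b)) ≡
    5 ℕ.* (b ℕ.* b) ℕ.+ (a ℕ.+ (b ℕ.+ a)) ℕ.* (a ℕ.+ (b ℕ.+ a))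
  rearrange = ℕSolver.solve-∀

-- Signs, and the doubling formulas at negative indices

[-1]^n*[-1]^n≡1 : ∀ n → -1ℤ ℤ.^ n ℤ.* -1ℤ ℤ.^ n ≡ + 1
[-1]^n*[-1]^n≡1 zero    = refl
[-1]^n*[-1]^n≡1 (suc n) = trans (rearrange (-1ℤ ℤ.^ n)) ([-1]^n*[-1]^n≡1 n)
  where
  rearrange : ∀ e → -1ℤ ℤ.* e ℤ.* (-1ℤ ℤ.* e) ≡ e ℤ.* e
  rearrange = ℤSolver.solve-∀

[-1]^[2*n]≡1 : ∀ n → -1ℤ ℤ.^ (2 ℕ.* n) ≡ + 1
[-1]^[2*n]≡1 n = begin
  -1ℤ ℤ.^ (2 ℕ.* n)              ≡⟨ cong (λ x → -1ℤ ℤ.^ (n ℕ.+ x)) (ℕ.+-identityʳ n) ⟩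
  -1ℤ ℤ.^ (n ℕ.+ n)              ≡⟨ ℤ.^-distribˡ-+-* -1ℤ n n ⟩
  -1ℤ ℤ.^ n ℤ.* -1ℤ ℤ.^ n        ≡⟨ [-1]^n*[-1]^n≡1 n ⟩
  + 1                            ∎
  where open ≡.≡-Reasoning

-- The exponent is the form in which F (+ 2 * -[1+ n ]) computes.

[-1]^[2*n+1]≡-1 : ∀ n → -1ℤ ℤ.^ (n ℕ.+ (suc n ℕ.+ 0)) ≡ -1ℤ
[-1]^[2*n+1]≡-1 n = begin
  x                      ≡⟨ rearrange x ⟩
  -1ℤ ℤ.* (-1ℤ ℤ.* x)    ≡⟨ cong (-1ℤ ℤ.*_) ([-1]^[2*n]≡1 (suc n)) ⟩
  -1ℤ                    ∎
  where
  open ≡.≡-Reasoning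
  x = -1ℤ ℤ.^ (n ℕ.+ (suc n ℕ.+ 0))
  rearrange : ∀ x → x ≡ -1ℤ ℤ.* (-1ℤ ℤ.* x)
  rearrange = ℤSolver.solve-∀

-- For negative `p` the sign of the left side is -1. On the right the signs of `F p` and `L p` are
-- consecutive powers of -1, whose product is again -1; inserting e² = 1 produces both.
F-double : ∀ p .{{_ : ℤ.NonZero p}} → F (+ 2 ℤ.* p) ≡ F p ℤ.* L p
F-double (+ suc n) = trans (cong +_ (fib-double n)) (ℤ.pos-* (fib (suc n)) (lucas (suc n)))
F-double -[1+ n ]  = begin
  -1ℤ ℤ.^ (n ℕ.+ (suc n ℕ.+ 0)) ℤ.* + fib (2 ℕ.* suc n)
    ≡⟨ cong₂ (λ x y → x ℤ.* + y) ([-1]^[2*n+1]≡-1 n) (fib-double n) ⟩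
  -1ℤ ℤ.* + (fib (suc n) ℕ.* lucas (suc n))
    ≡⟨ cong (-1ℤ ℤ.*_) (ℤ.pos-* (fib (suc n)) (lucas (suc n))) ⟩
  -1ℤ ℤ.* (f ℤ.* l)
    ≡⟨ cong (λ x → -1ℤ ℤ.* x ℤ.* (f ℤ.* l)) ([-1]^n*[-1]^n≡1 n) ⟨
  -1ℤ ℤ.* (e ℤ.* e) ℤ.* (f ℤ.* l)
    ≡⟨ rearrange e f l ⟩
  (e ℤ.* f) ℤ.* (-1ℤ ℤ.* e ℤ.* l) ∎
  where
  open ≡.≡-Reasoning
  e = -1ℤ ℤ.^ n
  f = + fib (suc n)
  l = + lucas (suc n)
  rearrange : ∀ e f l → -1ℤ ℤ.* (e ℤ.* e) ℤ.* (f ℤ.* l) ≡ (e ℤ.* f) ℤ.* (-1ℤ ℤ.* e ℤ.* l)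
  rearrange = ℤSolver.solve-∀

-- At a negative index the left side carries an even power of -1 and the right side only squares of
-- signs, so the formula reduces to the positive index.
L-double : ∀ p .{{_ : ℤ.NonZero p}} →
  + 2 ℤ.* L (+ 2 ℤ.* p) ≡ + 5 ℤ.* (F p ℤ.* F p) ℤ.+ L p ℤ.* L p
L-double (+ suc n) = begin
  + 2 ℤ.* + lucas (2 ℕ.* suc n)
    ≡⟨ ℤ.pos-* 2 (lucas (2 ℕ.* suc n)) ⟨
  + (2 ℕ.* lucas (2 ℕ.* suc n))
    ≡⟨ cong +_ (lucas-double n) ⟩
  + (5 ℕ.* (f ℕ.* f)) ℤ.+ + (l ℕ.* l)
    ≡⟨ cong₂ ℤ._+_ (trans (ℤ.pos-* 5 (f ℕ.* f)) (cong (+ 5 ℤ.*_) (ℤ.pos-* f f))) (ℤ.pos-* l l) ⟩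
  + 5 ℤ.* (+ f ℤ.* + f) ℤ.+ + l ℤ.* + l ∎
  where
  open ≡.≡-Reasoning
  f = fib (suc n)
  l = lucas (suc n)
L-double -[1+ n ]  = begin
  + 2 ℤ.* (-1ℤ ℤ.^ (2 ℕ.* suc n) ℤ.* + lucas (2 ℕ.* suc n))
    ≡⟨ cong (λ x → + 2 ℤ.* (x ℤ.* + lucas (2 ℕ.* suc n))) ([-1]^[2*n]≡1 (suc n)) ⟩
  + 2 ℤ.* (+ 1 ℤ.* + lucas (2 ℕ.* suc n))
    ≡⟨ cong (+ 2 ℤ.*_) (ℤ.*-identityˡ _) ⟩
  + 2 ℤ.* + lucas (2 ℕ.* suc n)
    ≡⟨ L-double (+ suc n) ⟩
  + 5 ℤ.* (f ℤ.* f) ℤ.+ l ℤ.* l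
    ≡⟨ ℤ.*-identityˡ _ ⟨
  + 1 ℤ.* (+ 5 ℤ.* (f ℤ.* f) ℤ.+ l ℤ.* l)
    ≡⟨ cong (ℤ._* (+ 5 ℤ.* (f ℤ.* f) ℤ.+ l ℤ.* l)) ([-1]^n*[-1]^n≡1 n) ⟨
  e ℤ.* e ℤ.* (+ 5 ℤ.* (f ℤ.* f) ℤ.+ l ℤ.* l)
    ≡⟨ rearrange e f l ⟩
  + 5 ℤ.* (e ℤ.* f ℤ.* (e ℤ.* f)) ℤ.+ -1ℤ ℤ.* e ℤ.* l ℤ.* (-1ℤ ℤ.* e ℤ.* l) ∎
  where
  open ≡.≡-Reasoning
  e = -1ℤ ℤ.^ n
  f = + fib (suc n)
  l = + lucas (suc n)
  rearrange : ∀ e f l → e ℤ.* e ℤ.* (+ 5 ℤ.* (f ℤ.* f) ℤ.+ l ℤ.* l) ≡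
    + 5 ℤ.* (e ℤ.* f ℤ.* (e ℤ.* f)) ℤ.+ -1ℤ ℤ.* e ℤ.* l ℤ.* (-1ℤ ℤ.* e ℤ.* l)
  rearrange = ℤSolver.solve-∀

-- Binomial sums and linear recurrences in a commutative ring

module _ {c ℓ} (R : CommutativeRing c ℓ) where

  open CommutativeRing R renaming
    (refl to ≈-refl; sym to ≈-sym; trans to ≈-trans)
  open Exp commutativeSemiring using (^-distrib-*)
  open Group +-group using (∙-cancelʳ; ⁻¹-involutive)
  open Mult +-monoid using (×-congˡ; ×-homo-+)
  open NaturalSolver commutativeSemiring using (solve; con; _:+_; _:*_; _:=_)
  open Ring ring using (-1*x≈-x)
  open SemiringExp semiring using (_^_; ^-congˡ)
  open SemiringMult semiring using (_×_; ×-comm-*)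
  open Sum semiring using (sum; sum-cong-≋; sum-init-last; ∑-distrib-+; *-distribˡ-sum)
  open import Relation.Binary.Reasoning.Setoid setoid

  [-1]^n*[-x]^n≈x^n : ∀ x n → (- 1#) ^ n * (- x) ^ n ≈ x ^ n
  [-1]^n*[-x]^n≈x^n x n = begin
    (- 1#) ^ n * (- x) ^ n  ≈⟨ ^-distrib-* (- 1#) (- x) n ⟨
    (- 1# * - x) ^ n        ≈⟨ ^-congˡ n (≈-trans (-1*x≈-x (- x)) (⁻¹-involutive x)) ⟩
    x ^ n                   ∎

  sum-toℕ-last : ∀ (f : ℕ → Carrier) n →
    sum {suc n} (f ∘ toℕ) ≈ sum {n} (f ∘ toℕ) + f n
  sum-toℕ-last f n = ≈-trans (sum-init-last (f ∘ toℕ)) (+-cong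
    (sum-cong-≋ {n} (λ i → reflexive (cong f (Fin.toℕ-inject₁ i))))
    (reflexive (cong f (Fin.toℕ-fromℕ n))))

  -- The recurrences are written with sums instead of differences, so that a semiring solver can
  -- verify them; cancelling `g n` recovers the next value.
  recurrence-unique : ∀ t (f g : ℕ → Carrier) →
    (∀ n → f (suc (suc n)) + f n ≈ t * f (suc n)) →
    (∀ n → g (suc (suc n)) + g n ≈ t * g (suc n)) →
    f 0 ≈ g 0 → f 1 ≈ g 1 → ∀ n → f n ≈ g n
  recurrence-unique t f g rf rg f0≈g0 f1≈g1 = go
    where
    go : ∀ n → f n ≈ g n
    go zero          = f0≈g0
    go (suc zero)    = f1≈g1
    go (suc (suc n)) = ∙-cancelʳ (g n) _ _ (begin
      f (suc (suc n)) + g n  ≈⟨ +-congˡ (go n) ⟨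
      f (suc (suc n)) + f n  ≈⟨ rf n ⟩
      t * f (suc n)          ≈⟨ *-congˡ (go (suc n)) ⟩
      t * g (suc n)          ≈⟨ rg n ⟨
      g (suc (suc n)) + g n  ∎)

  module _ (z : Carrier) where

    -- The form `k ℕ.* 2` is chosen because `suc k ℕ.* 2` computes to `suc (suc (k ℕ.* 2))`, which
    -- is what Pascal's rule expects.
    evenTerm oddTerm : ℕ → ℕ → Carrier
    evenTerm n k = ((n ℕ.+ k) C (k ℕ.* 2)) × z ^ k
    oddTerm  n k = (suc (n ℕ.+ k) C suc (k ℕ.* 2)) × z ^ k

    -- The number of summands `N` is separate from the index `n`, since the recurrences compare sums
    -- of different lengths.
    evenSum oddSum : ℕ → ℕ → Carrier
    evenSum N n = sum {N} (evenTerm n ∘ toℕ)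
    oddSum  N n = sum {N} (oddTerm n ∘ toℕ)

    -- The Morgan-Voyce polynomials b_n and B_n, evaluated at `z`.
    even odd : ℕ → Carrier
    even n = evenSum (suc n) n
    odd  n = oddSum (suc n) n

    -- The added term has the binomial C(n+N, 2N), which is zero because n + N < 2N.
    evenSum-last : ∀ {N n} → n ℕ.< N → evenSum (suc N) n ≈ evenSum N n
    evenSum-last {N} {n} n<N = begin
      evenSum (suc N) n           ≈⟨ sum-toℕ-last (evenTerm n) N ⟩
      evenSum N n + evenTerm n N  ≈⟨ +-congˡ (×-congˡ (k>n⇒nCk≡0 (m<n⇒m+n<n*2 n<N))) ⟩
      evenSum N n + 0#            ≈⟨ +-identityʳ _ ⟩
      evenSum N n                 ∎

    oddSum-last : ∀ {N n} → n ℕ.< N → oddSum (suc N) n ≈ oddSum N n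
    oddSum-last {N} {n} n<N = begin
      oddSum (suc N) n          ≈⟨ sum-toℕ-last (oddTerm n) N ⟩
      oddSum N n + oddTerm n N  ≈⟨ +-congˡ (×-congˡ (k>n⇒nCk≡0 (ℕ.s<s (m<n⇒m+n<n*2 n<N)))) ⟩
      oddSum N n + 0#           ≈⟨ +-identityʳ _ ⟩
      oddSum N n                ∎

    -- Pascal's rule lowers the upper index. The summand with odd lower index is `oddTerm n k` once
    -- one factor `z` is taken out.
    evenTerm-suc : ∀ n k → evenTerm (suc n) (suc k) ≈ evenTerm n (suc k) + z * oddTerm n k
    evenTerm-suc n k = begin
      (suc (n ℕ.+ suc k) C suc (suc (k ℕ.* 2))) × z ^ suc k
        ≈⟨ ×-congˡ (nCk+nC[k+1]≡[n+1]C[k+1] (n ℕ.+ suc k) (suc (k ℕ.* 2))) ⟨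
      ((n ℕ.+ suc k) C suc (k ℕ.* 2) ℕ.+ (n ℕ.+ suc k) C (suc k ℕ.* 2)) × z ^ suc k
        ≈⟨ ×-homo-+ (z ^ suc k) ((n ℕ.+ suc k) C suc (k ℕ.* 2)) _ ⟩
      ((n ℕ.+ suc k) C suc (k ℕ.* 2)) × z ^ suc k + evenTerm n (suc k)
        ≈⟨ +-comm _ _ ⟩
      evenTerm n (suc k) + ((n ℕ.+ suc k) C suc (k ℕ.* 2)) × z ^ suc k
        ≈⟨ +-congˡ (×-congˡ (cong (_C suc (k ℕ.* 2)) (ℕ.+-suc n k))) ⟩
      evenTerm n (suc k) + (suc (n ℕ.+ k) C suc (k ℕ.* 2)) × (z * z ^ k)
        ≈⟨ +-congˡ (×-comm-* (suc (n ℕ.+ k) C suc (k ℕ.* 2)) z (z ^ k)) ⟨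
      evenTerm n (suc k) + z * oddTerm n k ∎

    even-suc : ∀ n → even (suc n) ≈ even n + z * odd n
    even-suc n = begin
      -- Pascal's rule applies only to positive k. The terms of index 0 in `even (suc n)` and
      -- `even n` both compute to `h`.
      h + sum {suc n} (evenTerm (suc n) ∘ suc ∘ toℕ)
        ≈⟨ +-congˡ (sum-cong-≋ (evenTerm-suc n ∘ toℕ {suc n})) ⟩
      h + sum {suc n} (λ i → evenTerm n (suc (toℕ i)) + z * oddTerm n (toℕ i))
        ≈⟨ +-congˡ (∑-distrib-+ {suc n} (evenTerm n ∘ suc ∘ toℕ) (λ i → z * oddTerm n (toℕ i))) ⟩
      h + (sum {suc n} (evenTerm n ∘ suc ∘ toℕ) + sum {suc n} (λ i → z * oddTerm n (toℕ i)))
        ≈⟨ +-assoc _ _ _ ⟨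
      evenSum (suc (suc n)) n + sum {suc n} (λ i → z * oddTerm n (toℕ i))
        ≈⟨ +-cong (evenSum-last (ℕ.n<1+n n)) (≈-sym (*-distribˡ-sum {suc n} z (oddTerm n ∘ toℕ))) ⟩
      even n + z * odd n ∎
      where h = evenTerm n 0

    oddTerm-suc : ∀ n k → oddTerm (suc n) k ≈ oddTerm n k + evenTerm (suc n) k
    oddTerm-suc n k = begin
      (suc (suc n ℕ.+ k) C suc (k ℕ.* 2)) × z ^ k
        ≈⟨ ×-congˡ (nCk+nC[k+1]≡[n+1]C[k+1] (suc n ℕ.+ k) (k ℕ.* 2)) ⟨
      ((suc n ℕ.+ k) C (k ℕ.* 2) ℕ.+ (suc n ℕ.+ k) C suc (k ℕ.* 2)) × z ^ k
        ≈⟨ ×-homo-+ (z ^ k) ((suc n ℕ.+ k) C (k ℕ.* 2)) _ ⟩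
      evenTerm (suc n) k + oddTerm n k
        ≈⟨ +-comm _ _ ⟩
      oddTerm n k + evenTerm (suc n) k ∎

    odd-suc : ∀ n → odd (suc n) ≈ odd n + even (suc n)
    odd-suc n = begin
      odd (suc n)
        ≈⟨ sum-cong-≋ (oddTerm-suc n ∘ toℕ {suc (suc n)}) ⟩
      sum {suc (suc n)} (λ i → oddTerm n (toℕ i) + evenTerm (suc n) (toℕ i))
        ≈⟨ ∑-distrib-+ {suc (suc n)} (oddTerm n ∘ toℕ) (evenTerm (suc n) ∘ toℕ) ⟩
      oddSum (suc (suc n)) n + even (suc n)
        ≈⟨ +-congʳ (oddSum-last (ℕ.n<1+n n)) ⟩
      odd n + even (suc n) ∎

    -- Eliminates `odd`: after both one-step rules are unfolded, `even n + z * odd n` reappears and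
    -- is folded back into `even (suc n)`.
    even-recurrence : ∀ n → even (suc (suc n)) + even n ≈ (z + (1# + 1#)) * even (suc n)
    even-recurrence n = begin
      even (suc (suc n)) + even n
        ≈⟨ +-congʳ (even-suc (suc n)) ⟩
      even (suc n) + z * odd (suc n) + even n
        ≈⟨ +-congʳ (+-congˡ (*-congˡ (odd-suc n))) ⟩
      even (suc n) + z * (odd n + even (suc n)) + even n
        ≈⟨ solve 4 (λ z a b c → b :+ z :* (c :+ b) :+ a := (a :+ z :* c) :+ (b :+ z :* b))
             ≈-refl z (even n) (even (suc n)) (odd n) ⟩
      (even n + z * odd n) + (even (suc n) + z * even (suc n))
        ≈⟨ +-congʳ (even-suc n) ⟨
      even (suc n) + (even (suc n) + z * even (suc n))
        ≈⟨ solve 2 (λ z b → b :+ (b :+ z :* b) := (z :+ (con 1 :+ con 1)) :* b)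
             ≈-refl z (even (suc n)) ⟩
      (z + (1# + 1#)) * even (suc n) ∎

    -- The Lucas sequence V_n(z+2, 1). Running the recurrence of `even` backwards gives the value 1
    -- at index -1, whence the initial value 2, which is also that of pⁿ + qⁿ.
    evenPair : ℕ → Carrier
    evenPair zero    = 1# + 1#
    evenPair (suc n) = even (suc n) + even n

    even-zero : even 0 ≈ 1#
    even-zero = ≈-trans (+-identityʳ _) (+-identityʳ _)

    odd-zero : odd 0 ≈ 1#
    odd-zero = ≈-trans (+-identityʳ _) (+-identityʳ _)

    evenPair-one : evenPair 1 ≈ z + (1# + 1#)
    evenPair-one = begin
      even 1 + even 0               ≈⟨ +-congʳ (even-suc 0) ⟩
      even 0 + z * odd 0 + even 0   ≈⟨ +-cong (+-cong even-zero (*-congˡ odd-zero)) even-zero ⟩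
      1# + z * 1# + 1#              ≈⟨ solve 1 (λ z → con 1 :+ z :* con 1 :+ con 1 := z :+ (con 1 :+ con 1)) ≈-refl z ⟩
      z + (1# + 1#)                 ∎

    evenPair-recurrence : ∀ n →
      evenPair (suc (suc n)) + evenPair n ≈ (z + (1# + 1#)) * evenPair (suc n)
    evenPair-recurrence zero = begin
      even 2 + even 1 + (1# + 1#)
        -- The initial value 2 is written as two copies of `even 0`: one completes the recurrence
        -- for `even 2`, the other completes `evenPair 1`, which is `t`.
        ≈⟨ +-congˡ (+-cong even-zero even-zero) ⟨
      even 2 + even 1 + (even 0 + even 0)
        ≈⟨ solve 3 (λ a b c → c :+ b :+ (a :+ a) := (c :+ a) :+ (b :+ a))
             ≈-refl (even 0) (even 1) (even 2) ⟩
      (even 2 + even 0) + (even 1 + even 0)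
        ≈⟨ +-cong (even-recurrence 0) evenPair-one ⟩
      t * even 1 + t
        ≈⟨ +-congˡ (≈-trans (*-congˡ even-zero) (*-identityʳ t)) ⟨
      t * even 1 + t * even 0
        ≈⟨ distribˡ t _ _ ⟨
      t * (even 1 + even 0) ∎
      where t = z + (1# + 1#)
    evenPair-recurrence (suc n) = begin
      even (3 ℕ.+ n) + even (2 ℕ.+ n) + (even (1 ℕ.+ n) + even n)
        ≈⟨ solve 4 (λ a b c d → d :+ c :+ (b :+ a) := (d :+ b) :+ (c :+ a))
             ≈-refl (even n) (even (1 ℕ.+ n)) (even (2 ℕ.+ n)) (even (3 ℕ.+ n)) ⟩
      (even (3 ℕ.+ n) + even (1 ℕ.+ n)) + (even (2 ℕ.+ n) + even n)
        ≈⟨ +-cong (even-recurrence (suc n)) (even-recurrence n) ⟩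
      t * even (2 ℕ.+ n) + t * even (1 ℕ.+ n)
        ≈⟨ distribˡ t _ _ ⟨
      t * (even (2 ℕ.+ n) + even (1 ℕ.+ n)) ∎
      where t = z + (1# + 1#)

    sum-coeff≈evenPair : ∀ m →
      sum {suc (suc m)} (λ i → coeff m (toℕ i) × z ^ toℕ i) ≈ evenPair (suc m)
    sum-coeff≈evenPair m = begin
      sum {suc (suc m)} (λ i → coeff m (toℕ i) × z ^ toℕ i)
        ≈⟨ sum-cong-≋ {suc (suc m)} (λ i →
             ×-homo-+ (z ^ toℕ i) ((suc m ℕ.+ toℕ i) C (toℕ i ℕ.* 2))
               ((m ℕ.+ toℕ i) C (toℕ i ℕ.* 2))) ⟩
      sum {suc (suc m)} (λ i → evenTerm (suc m) (toℕ i) + evenTerm m (toℕ i))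
        ≈⟨ ∑-distrib-+ {suc (suc m)} (evenTerm (suc m) ∘ toℕ) (evenTerm m ∘ toℕ) ⟩
      even (suc m) + evenSum (suc (suc m)) m
        -- The second binomial of `coeff` yields a sum with one term more than `even m`; its last
        -- term vanishes.
        ≈⟨ +-congˡ (evenSum-last (ℕ.n<1+n m)) ⟩
      even (suc m) + even m ∎

  powerSum-recurrence : ∀ p q → p * q ≈ 1# → ∀ n →
    (p ^ suc (suc n) + q ^ suc (suc n)) + (p ^ n + q ^ n) ≈ (p + q) * (p ^ suc n + q ^ suc n)
  powerSum-recurrence p q pq≈1 n = begin
    (p * (p * a) + q * (q * b)) + (a + b)
      -- Multiplying the lower powers by pq = 1 turns the claim into a polynomial identity.
      ≈⟨ +-congˡ (≈-trans (*-congʳ pq≈1) (*-identityˡ _)) ⟨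
    (p * (p * a) + q * (q * b)) + p * q * (a + b)
      ≈⟨ solve 4 (λ p q a b →
           (p :* (p :* a) :+ q :* (q :* b)) :+ p :* q :* (a :+ b) :=
           (p :+ q) :* (p :* a :+ q :* b)) ≈-refl p q a b ⟩
    (p + q) * (p * a + q * b) ∎
    where
    a = p ^ n
    b = q ^ n

  -- Both sides satisfy the recurrence with multiplier z + 2 = p + q. At index 0 both are 2, and at
  -- index 1 they are z + 2 and p + q.
  sum-coeff : ∀ z p q → p * q ≈ 1# → z + (1# + 1#) ≈ p + q → ∀ m →
    sum {suc (suc m)} (λ i → coeff m (toℕ i) × z ^ toℕ i) ≈ p ^ suc m + q ^ suc m
  sum-coeff z p q pq≈1 z+2≈p+q m = ≈-trans (sum-coeff≈evenPair z m)
    (recurrence-unique (z + (1# + 1#)) (evenPair z) (λ n → p ^ n + q ^ n)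
      (evenPair-recurrence z)
      (λ n → ≈-trans (powerSum-recurrence p q pq≈1 n) (*-congʳ (≈-sym z+2≈p+q)))
      ≈-refl
      (≈-trans (evenPair-one z) (≈-trans z+2≈p+q (≈-sym (+-cong (*-identityʳ p) (*-identityʳ q)))))
      (suc m))

-- The ring structure of ℚ(√5)

open import Defs

-- The multiplicative laws hold with any rational in place of 5, so `5ℚ` is passed to the solver as
-- a variable.
+-*-isCommutativeRing : IsCommutativeRing _≡_ _+_ _*_ -_ (fromℚ 0ℚ) (fromℚ 1ℚ)
+-*-isCommutativeRing = record
  { isRing = record
    { +-isAbelianGroup = record
      { isGroup = record
        { isMonoid = record
          { isSemigroup = record
            { isMagma = record { isEquivalence = ≡.isEquivalence ; ∙-cong = cong₂ _+_ }
            ; assoc   = λ (a +√5 b) (c +√5 d) (e +√5 f) →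
                cong₂ _+√5_ (ℚ.+-assoc a c e) (ℚ.+-assoc b d f)
            }
          ; identity = (λ (a +√5 b) → cong₂ _+√5_ (ℚ.+-identityˡ a) (ℚ.+-identityˡ b))
                     , (λ (a +√5 b) → cong₂ _+√5_ (ℚ.+-identityʳ a) (ℚ.+-identityʳ b))
          }
        ; inverse = (λ (a +√5 b) → cong₂ _+√5_ (ℚ.+-inverseˡ a) (ℚ.+-inverseˡ b))
                  , (λ (a +√5 b) → cong₂ _+√5_ (ℚ.+-inverseʳ a) (ℚ.+-inverseʳ b))
        ; ⁻¹-cong = cong -_
        }
      ; comm = λ (a +√5 b) (c +√5 d) → cong₂ _+√5_ (ℚ.+-comm a c) (ℚ.+-comm b d)
      }
    ; *-cong     = cong₂ _*_
    ; *-assoc    = *-assoc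
    ; *-identity = *-identityˡ , λ x → trans (*-comm x (fromℚ 1ℚ)) (*-identityˡ x)
    ; distrib    = *-distribˡ-+ , λ x y z →
        trans (*-comm (y + z) x) (trans (*-distribˡ-+ x y z) (cong₂ _+_ (*-comm x y) (*-comm x z)))
    }
  ; *-comm = *-comm
  }
  where
  open +-*-Solver

  *-comm : ∀ x y → x * y ≡ y * x
  *-comm (a +√5 b) (c +√5 d) = cong₂ _+√5_
    (solve 5 (λ a b c d s → a :* c :+ s :* (b :* d) := c :* a :+ s :* (d :* b)) refl a b c d 5ℚ)
    (solve 4 (λ a b c d → a :* d :+ b :* c := c :* b :+ d :* a) refl a b c d)

  *-assoc : ∀ x y z → (x * y) * z ≡ x * (y * z)
  *-assoc (a +√5 b) (c +√5 d) (e +√5 f) = cong₂ _+√5_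
    (solve 7 (λ a b c d e f s →
      (a :* c :+ s :* (b :* d)) :* e :+ s :* ((a :* d :+ b :* c) :* f) :=
      a :* (c :* e :+ s :* (d :* f)) :+ s :* (b :* (c :* f :+ d :* e))) refl a b c d e f 5ℚ)
    (solve 7 (λ a b c d e f s →
      (a :* c :+ s :* (b :* d)) :* f :+ (a :* d :+ b :* c) :* e :=
      a :* (c :* f :+ d :* e) :+ b :* (c :* e :+ s :* (d :* f))) refl a b c d e f 5ℚ)

  *-identityˡ : ∀ x → fromℚ 1ℚ * x ≡ x
  *-identityˡ (a +√5 b) = cong₂ _+√5_
    (solve 3 (λ a b s → con 1ℚ :* a :+ s :* (con 0ℚ :* b) := a) refl a b 5ℚ)
    (solve 2 (λ a b → con 1ℚ :* b :+ con 0ℚ :* a := b) refl a b)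

  *-distribˡ-+ : ∀ x y z → x * (y + z) ≡ x * y + x * z
  *-distribˡ-+ (a +√5 b) (c +√5 d) (e +√5 f) = cong₂ _+√5_
    (solve 7 (λ a b c d e f s →
      a :* (c :+ e) :+ s :* (b :* (d :+ f)) :=
      (a :* c :+ s :* (b :* d)) :+ (a :* e :+ s :* (b :* f))) refl a b c d e f 5ℚ)
    (solve 6 (λ a b c d e f →
      a :* (d :+ f) :+ b :* (c :+ e) :=
      (a :* d :+ b :* c) :+ (a :* f :+ b :* e)) refl a b c d e f)

+-*-commutativeRing : CommutativeRing 0ℓ 0ℓ
+-*-commutativeRing = record { isCommutativeRing = +-*-isCommutativeRing }

-- Embedding ℤ and ℚ into ℚ(√5)

-- `ℚ.toℚᵘ` is injective and undoes normalisation up to equivalence, so the claim is checked on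
-- unnormalised fractions.
fromℚᵘ-homo-+ : ∀ p q → ℚ.fromℚᵘ (p ℚᵘ.+ q) ≡ ℚ.fromℚᵘ p ℚ.+ ℚ.fromℚᵘ q
fromℚᵘ-homo-+ p q = ℚ.toℚᵘ-injective (begin
  ℚ.toℚᵘ (ℚ.fromℚᵘ (p ℚᵘ.+ q))                        ≈⟨ ℚ.toℚᵘ-fromℚᵘ (p ℚᵘ.+ q) ⟩
  p ℚᵘ.+ q                                            ≈⟨ ℚᵘ.+-cong (ℚ.toℚᵘ-fromℚᵘ p) (ℚ.toℚᵘ-fromℚᵘ q) ⟨
  ℚ.toℚᵘ (ℚ.fromℚᵘ p) ℚᵘ.+ ℚ.toℚᵘ (ℚ.fromℚᵘ q)        ≈⟨ ℚ.toℚᵘ-homo-+ (ℚ.fromℚᵘ p) (ℚ.fromℚᵘ q) ⟨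
  ℚ.toℚᵘ (ℚ.fromℚᵘ p ℚ.+ ℚ.fromℚᵘ q)                  ∎)
  where open import Relation.Binary.Reasoning.Setoid ℚᵘ.≃-setoid

fromℚᵘ-homo-* : ∀ p q → ℚ.fromℚᵘ (p ℚᵘ.* q) ≡ ℚ.fromℚᵘ p ℚ.* ℚ.fromℚᵘ q
fromℚᵘ-homo-* p q = ℚ.toℚᵘ-injective (begin
  ℚ.toℚᵘ (ℚ.fromℚᵘ (p ℚᵘ.* q))                        ≈⟨ ℚ.toℚᵘ-fromℚᵘ (p ℚᵘ.* q) ⟩
  p ℚᵘ.* q                                            ≈⟨ ℚᵘ.*-cong (ℚ.toℚᵘ-fromℚᵘ p) (ℚ.toℚᵘ-fromℚᵘ q) ⟨
  ℚ.toℚᵘ (ℚ.fromℚᵘ p) ℚᵘ.* ℚ.toℚᵘ (ℚ.fromℚᵘ q)        ≈⟨ ℚ.toℚᵘ-homo-* (ℚ.fromℚᵘ p) (ℚ.fromℚᵘ q) ⟨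
  ℚ.toℚᵘ (ℚ.fromℚᵘ p ℚ.* ℚ.fromℚᵘ q)                  ∎)
  where open import Relation.Binary.Reasoning.Setoid ℚᵘ.≃-setoid

fromℚ-homo-* : ∀ p q → fromℚ (p ℚ.* q) ≡ fromℚ p * fromℚ q
fromℚ-homo-* p q = cong₂ _+√5_
  (solve 3 (λ p q s → p :* q := p :* q :+ s :* (con 0ℚ :* con 0ℚ)) refl p q 5ℚ)
  (solve 2 (λ p q → con 0ℚ := p :* con 0ℚ :+ con 0ℚ :* q) refl p q)
  where open +-*-Solver

fromℤ-homo-* : ∀ i j → fromℤ (i ℤ.* j) ≡ fromℤ i * fromℤ j
fromℤ-homo-* i j = trans
  (cong fromℚ (fromℚᵘ-homo-* (mkℚᵘ i 0) (mkℚᵘ j 0))) (fromℚ-homo-* (i ℚ./ 1) (j ℚ./ 1))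

fromℤ-homo-+ : ∀ i j → fromℤ (i ℤ.+ j) ≡ fromℤ i + fromℤ j
fromℤ-homo-+ i j = cong fromℚ (trans
  -- Adding fractions with denominator 1 gives the numerator i·1 + j·1, which equals i + j only
  -- after a rearrangement; for products the corresponding fractions agree by computation.
  (ℚ.fromℚᵘ-cong {mkℚᵘ (i ℤ.+ j) 0} {mkℚᵘ i 0 ℚᵘ.+ mkℚᵘ j 0} (*≡* (rearrange i j)))
  (fromℚᵘ-homo-+ (mkℚᵘ i 0) (mkℚᵘ j 0)))
  where
  rearrange : ∀ i j → (i ℤ.+ j) ℤ.* + 1 ≡ (i ℤ.* + 1 ℤ.+ j ℤ.* + 1) ℤ.* + 1
  rearrange = ℤSolver.solve-∀

-- The sum with base u + v, where uv = 1

open CommutativeRing +-*-commutativeRing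
  using (semiring; commutativeSemiring; *-comm; *-assoc; *-identityˡ; *-identityʳ; distribʳ; zeroˡ)
open Exp commutativeSemiring using (^-distrib-*)
open SemiringExp semiring using (^-assocʳ; ^-homo-*)
open SemiringMult semiring using (_×_)
open Sum semiring using (sum-cong-≋; *-distribˡ-sum)

fromℕ-* : ∀ n x → fromℕ n * x ≡ n × x
fromℕ-* zero    x = zeroˡ x
fromℕ-* (suc n) x = begin
  fromℕ (suc n) * x                ≡⟨ cong (_* x) (fromℤ-homo-+ (+ 1) (+ n)) ⟩
  (fromℚ 1ℚ + fromℕ n) * x         ≡⟨ distribʳ x (fromℚ 1ℚ) (fromℕ n) ⟩
  fromℚ 1ℚ * x + fromℕ n * x       ≡⟨ cong₂ _+_ (*-identityˡ x) (fromℕ-* n x) ⟩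
  x + n × x                        ∎
  where open ≡.≡-Reasoning

-- Equality of unnormalised fractions is equality of cross products, and here that is `coeff-spec`.
-- As `mkℚᵘ` takes the denominator minus one, `m ℕ.+ k` encodes n + k and `mkℚᵘ (+ 1) 1` is one
-- half.
fraction-coeff : ∀ m k → k ℕ.≤ suc m →
  fromℚ (+ suc m ℚ./ (suc m ℕ.+ k)) * fromℕ ((suc m ℕ.+ k) C (suc m ∸ k)) ≡
  fromℚ ½ * fromℕ (coeff m k)
fraction-coeff m k k≤n = begin
  fromℚ (+ n ℚ./ (n ℕ.+ k)) * fromℕ c
    ≡⟨ fromℚ-homo-* (+ n ℚ./ (n ℕ.+ k)) (+ c ℚ./ 1) ⟨
  fromℚ ((+ n ℚ./ (n ℕ.+ k)) ℚ.* (+ c ℚ./ 1))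
    ≡⟨ cong fromℚ (fromℚᵘ-homo-* (mkℚᵘ (+ n) (m ℕ.+ k)) (mkℚᵘ (+ c) 0)) ⟨
  fromℚ (ℚ.fromℚᵘ (mkℚᵘ (+ n) (m ℕ.+ k) ℚᵘ.* mkℚᵘ (+ c) 0))
    ≡⟨ cong fromℚ (ℚ.fromℚᵘ-cong {mkℚᵘ (+ n) (m ℕ.+ k) ℚᵘ.* mkℚᵘ (+ c) 0}
         {mkℚᵘ (+ 1) 1 ℚᵘ.* mkℚᵘ (+ a) 0} (*≡* cross-multiplied)) ⟩
  fromℚ (ℚ.fromℚᵘ (mkℚᵘ (+ 1) 1 ℚᵘ.* mkℚᵘ (+ a) 0))
    ≡⟨ cong fromℚ (fromℚᵘ-homo-* (mkℚᵘ (+ 1) 1) (mkℚᵘ (+ a) 0)) ⟩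
  fromℚ (½ ℚ.* (+ a ℚ./ 1))
    ≡⟨ fromℚ-homo-* ½ (+ a ℚ./ 1) ⟩
  fromℚ ½ * fromℕ a ∎
  where
  open ≡.≡-Reasoning
  n = suc m
  c = (n ℕ.+ k) C (n ∸ k)
  a = coeff m k

  cross-multiplied : + n ℤ.* + c ℤ.* + 2 ≡ + 1 ℤ.* + a ℤ.* + (suc (m ℕ.+ k) ℕ.* 1)
  cross-multiplied = begin
    + n ℤ.* + c ℤ.* + 2                         ≡⟨ cong (ℤ._* + 2) (ℤ.pos-* n c) ⟨
    + (n ℕ.* c) ℤ.* + 2                         ≡⟨ ℤ.pos-* (n ℕ.* c) 2 ⟨
    + (n ℕ.* c ℕ.* 2)                           ≡⟨ cong +_ (coeff-spec m k k≤n) ⟩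
    + (a ℕ.* (n ℕ.+ k))                         ≡⟨ ℤ.pos-* a (n ℕ.+ k) ⟩
    + a ℤ.* + (n ℕ.+ k)
      ≡⟨ cong₂ (λ x y → x ℤ.* + y) (ℤ.*-identityˡ (+ a)) (ℕ.*-identityʳ (n ℕ.+ k)) ⟨
    + 1 ℤ.* + a ℤ.* + (suc (m ℕ.+ k) ℕ.* 1)     ∎

^-square : ∀ x n → (x * x) ^ n ≡ x ^ (2 ℕ.* n)
^-square x n = trans (cong (λ y → (x * y) ^ n) (sym (*-identityʳ x))) (^-assocʳ x 2 n)

-- Writing (x²)ᵏ as (-1)ᵏ(-x²)ᵏ completes the sign to (-1)ⁿ, which is independent of k and can leave
-- the sum.
[-1]^[n∸k]*x^[2*k] : ∀ x {n k} → k ℕ.≤ n →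
  (- fromℚ 1ℚ) ^ (n ∸ k) * x ^ (2 ℕ.* k) ≡ (- fromℚ 1ℚ) ^ n * (- (x * x)) ^ k
[-1]^[n∸k]*x^[2*k] x {n} {k} k≤n = begin
  ε ^ (n ∸ k) * x ^ (2 ℕ.* k)                 ≡⟨ cong (ε ^ (n ∸ k) *_) (^-square x k) ⟨
  ε ^ (n ∸ k) * (x * x) ^ k
    ≡⟨ cong (ε ^ (n ∸ k) *_) ([-1]^n*[-x]^n≈x^n +-*-commutativeRing (x * x) k) ⟨
  ε ^ (n ∸ k) * (ε ^ k * (- (x * x)) ^ k)     ≡⟨ *-assoc (ε ^ (n ∸ k)) _ _ ⟨
  ε ^ (n ∸ k) * ε ^ k * (- (x * x)) ^ k       ≡⟨ cong (_* (- (x * x)) ^ k) (^-homo-* ε (n ∸ k) k) ⟨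
  ε ^ (n ∸ k ℕ.+ k) * (- (x * x)) ^ k         ≡⟨ cong (λ j → ε ^ j * (- (x * x)) ^ k) (ℕ.m∸n+n≡m k≤n) ⟩
  ε ^ n * (- (x * x)) ^ k                     ∎
  where
  open ≡.≡-Reasoning
  ε = - fromℚ 1ℚ

open NaturalSolver commutativeSemiring using (solve; _:+_; _:*_; _:=_)

sum-u+v : ∀ u v → u * v ≡ fromℚ 1ℚ → ∀ m →
  ∑[ k ≤ suc m ] ( (- fromℚ 1ℚ) ^ (suc m ∸ k)
                   * fromℚ (+ suc m ℚ./ (suc m ℕ.+ k))
                   * fromℕ ((suc m ℕ.+ k) C (suc m ∸ k))
                   * (u + v) ^ (2 ℕ.* k) )
  ≡ fromℚ ½ * (u ^ (2 ℕ.* suc m) + v ^ (2 ℕ.* suc m))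
sum-u+v u v uv≡1 m = begin
  sum {suc n} (term ∘ toℕ)
    ≡⟨ sum-cong-≋ {suc n} (λ i → term≡ (toℕ i) (ℕ.s≤s⁻¹ (Fin.toℕ<n i))) ⟩
  sum {suc n} (λ i → h * ε ^ n * (coeff m (toℕ i) × z ^ toℕ i))
    ≡⟨ *-distribˡ-sum {suc n} (h * ε ^ n) (λ i → coeff m (toℕ i) × z ^ toℕ i) ⟨
  h * ε ^ n * sum {suc n} (λ i → coeff m (toℕ i) × z ^ toℕ i)
    ≡⟨ cong (h * ε ^ n *_) (sum-coeff +-*-commutativeRing z p q pq≡1 z+2≡p+q m) ⟩
  h * ε ^ n * (p ^ n + q ^ n)
    ≡⟨ solve 4 (λ h e a b → h :* e :* (a :+ b) := h :* (e :* a :+ e :* b)) refl h (ε ^ n) (p ^ n) (q ^ n) ⟩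
  h * (ε ^ n * p ^ n + ε ^ n * q ^ n)
    -- The sign (-1)ⁿ taken out of the sum is absorbed here: it turns (-u²)ⁿ and (-v²)ⁿ into the
    -- even powers of u and v.
    ≡⟨ cong₂ (λ x y → h * (x + y)) (power u) (power v) ⟩
  h * (u ^ (2 ℕ.* n) + v ^ (2 ℕ.* n)) ∎
  where
  open ≡.≡-Reasoning
  n = suc m
  h = fromℚ ½
  ε = - fromℚ 1ℚ
  p = - (u * u)
  q = - (v * v)
  z = - ((u + v) * (u + v))

  term : ℕ → ℚ[√5]
  term k = ε ^ (n ∸ k) * fromℚ (+ n ℚ./ (n ℕ.+ k)) * fromℕ ((n ℕ.+ k) C (n ∸ k)) * (u + v) ^ (2 ℕ.* k)

  term≡ : ∀ k → k ℕ.≤ n → term k ≡ h * ε ^ n * (coeff m k × z ^ k)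
  term≡ k k≤n = begin
    ε ^ (n ∸ k) * r * c * (u + v) ^ (2 ℕ.* k)
      ≡⟨ solve 4 (λ e r c x → e :* r :* c :* x := (r :* c) :* (e :* x)) refl
           (ε ^ (n ∸ k)) r c ((u + v) ^ (2 ℕ.* k)) ⟩
    (r * c) * (ε ^ (n ∸ k) * (u + v) ^ (2 ℕ.* k))
      ≡⟨ cong₂ _*_ (fraction-coeff m k k≤n) ([-1]^[n∸k]*x^[2*k] (u + v) k≤n) ⟩
    (h * fromℕ (coeff m k)) * (ε ^ n * z ^ k)
      ≡⟨ solve 4 (λ h a e x → (h :* a) :* (e :* x) := h :* e :* (a :* x)) refl
           h (fromℕ (coeff m k)) (ε ^ n) (z ^ k) ⟩
    h * ε ^ n * (fromℕ (coeff m k) * z ^ k)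
      ≡⟨ cong (h * ε ^ n *_) (fromℕ-* (coeff m k) (z ^ k)) ⟩
    h * ε ^ n * (coeff m k × z ^ k) ∎
    where
    r = fromℚ (+ n ℚ./ (n ℕ.+ k))
    c = fromℕ ((n ℕ.+ k) C (n ∸ k))

  power : ∀ x → ε ^ n * (- (x * x)) ^ n ≡ x ^ (2 ℕ.* n)
  power x = trans ([-1]^n*[-x]^n≈x^n +-*-commutativeRing (x * x) n) (^-square x n)

  open Ring (CommutativeRing.ring +-*-commutativeRing)
    using (-‿distribˡ-*; -‿distribʳ-*; -‿+-comm; -‿involutive)

  pq≡1 : p * q ≡ fromℚ 1ℚ
  pq≡1 = begin
    - (u * u) * - (v * v)      ≡⟨ -‿distribˡ-* (u * u) (- (v * v)) ⟨
    - (u * u * - (v * v))      ≡⟨ cong -_ (-‿distribʳ-* (u * u) (v * v)) ⟨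
    - - (u * u * (v * v))      ≡⟨ -‿involutive _ ⟩
    u * u * (v * v)            ≡⟨ solve 2 (λ u v → u :* u :* (v :* v) := u :* v :* (u :* v)) refl u v ⟩
    u * v * (u * v)            ≡⟨ cong₂ _*_ uv≡1 uv≡1 ⟩
    fromℚ 1ℚ                   ∎

  z+2≡p+q : z + (fromℚ 1ℚ + fromℚ 1ℚ) ≡ p + q
  z+2≡p+q = begin
    - ((u + v) * (u + v)) + two
      ≡⟨ cong (λ x → - x + two) (solve 2 (λ u v →
           (u :+ v) :* (u :+ v) := (u :* u :+ v :* v) :+ (u :* v :+ u :* v)) refl u v) ⟩
    - ((u * u + v * v) + (u * v + u * v)) + two
      ≡⟨ cong (λ x → - ((u * u + v * v) + (x + x)) + two) uv≡1 ⟩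
    - ((u * u + v * v) + two) + two
      ≡⟨ cong (_+ two) (-‿+-comm (u * u + v * v) two) ⟨
    - (u * u + v * v) + - two + two
      ≡⟨ CommutativeRing.+-assoc +-*-commutativeRing (- (u * u + v * v)) (- two) two ⟩
    - (u * u + v * v) + (- two + two)
      ≡⟨⟩
    - (u * u + v * v) + fromℚ 0ℚ
      ≡⟨ CommutativeRing.+-identityʳ +-*-commutativeRing _ ⟩
    - (u * u + v * v)
      ≡⟨ -‿+-comm (u * u) (v * v) ⟨
    p + q ∎
    where two = fromℚ 1ℚ + fromℚ 1ℚ

-- Specialisation to Fibonacci and Lucas numbers

module _ (p : ℤ) .{{_ : ℤ.NonZero p}} where

  private
    f l f₂ l₂ √5f⁻¹ l⁻¹ √5f₂⁻¹ : ℚ[√5]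
    f      = fromℤ (F p)
    l      = fromℤ (L p)
    f₂     = fromℤ (F (+ 2 ℤ.* p))
    l₂     = fromℤ (L (+ 2 ℤ.* p))
    √5f⁻¹  = ((√5 * f) ⁻¹) {{√5F-nonZero p}}
    l⁻¹    = (l ⁻¹) {{L-nonZero p}}
    √5f₂⁻¹ = ((√5 * f₂) ⁻¹) {{√5F2-nonZero p}}

    √5f-inverse : √5 * f * √5f⁻¹ ≡ fromℚ 1ℚ
    √5f-inverse = *-inverseʳ (√5 * f) {{√5F-nonZero p}}

    l-inverse : l * l⁻¹ ≡ fromℚ 1ℚ
    l-inverse = *-inverseʳ l {{L-nonZero p}}

    √5f₂-inverse : √5 * f₂ * √5f₂⁻¹ ≡ fromℚ 1ℚ
    √5f₂-inverse = *-inverseʳ (√5 * f₂) {{√5F2-nonZero p}}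

    f₂≡f*l : f₂ ≡ f * l
    f₂≡f*l = trans (cong fromℤ (F-double p)) (fromℤ-homo-* (F p) (L p))

    2*l₂≡5*f²+l² : fromℕ 2 * l₂ ≡ fromℕ 5 * (f * f) + l * l
    2*l₂≡5*f²+l² = begin
      fromℕ 2 * l₂
        ≡⟨ fromℤ-homo-* (+ 2) (L (+ 2 ℤ.* p)) ⟨
      fromℤ (+ 2 ℤ.* L (+ 2 ℤ.* p))
        ≡⟨ cong fromℤ (L-double p) ⟩
      fromℤ (+ 5 ℤ.* (F p ℤ.* F p) ℤ.+ L p ℤ.* L p)
        ≡⟨ fromℤ-homo-+ (+ 5 ℤ.* (F p ℤ.* F p)) (L p ℤ.* L p) ⟩
      fromℤ (+ 5 ℤ.* (F p ℤ.* F p)) + fromℤ (L p ℤ.* L p)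
        ≡⟨ cong₂ _+_ (fromℤ-homo-* (+ 5) (F p ℤ.* F p)) (fromℤ-homo-* (L p) (L p)) ⟩
      fromℕ 5 * fromℤ (F p ℤ.* F p) + l * l
        ≡⟨ cong (λ x → fromℕ 5 * x + l * l) (fromℤ-homo-* (F p) (F p)) ⟩
      fromℕ 5 * (f * f) + l * l ∎
      where open ≡.≡-Reasoning

  √5F/L L/√5F : ℚ[√5]
  √5F/L = √5 * f * l⁻¹
  L/√5F = l * √5f⁻¹

  √5F/L*L/√5F≡1 : √5F/L * L/√5F ≡ fromℚ 1ℚ
  √5F/L*L/√5F≡1 = begin
    (√5 * f * l⁻¹) * (l * √5f⁻¹)
      ≡⟨ solve 4 (λ x b l a → (x :* b) :* (l :* a) := (x :* a) :* (l :* b)) refl (√5 * f) l⁻¹ l √5f⁻¹ ⟩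
    (√5 * f * √5f⁻¹) * (l * l⁻¹)
      ≡⟨ cong₂ _*_ √5f-inverse l-inverse ⟩
    fromℚ 1ℚ ∎
    where open ≡.≡-Reasoning

  2*L₂/√5F₂≡√5F/L+L/√5F : fromℕ 2 * l₂ * √5f₂⁻¹ ≡ √5F/L + L/√5F
  2*L₂/√5F₂≡√5F/L+L/√5F = begin
    fromℕ 2 * l₂ * √5f₂⁻¹
      ≡⟨ cong (_* √5f₂⁻¹) 2*l₂≡5*f²+l² ⟩
    -- `√5 * √5` computes to `fromℕ 5`.
    (√5 * √5 * (f * f) + l * l) * √5f₂⁻¹
      ≡⟨ cong (_* √5f₂⁻¹) (cong₂ _+_ (*-identityʳ (√5 * √5 * (f * f))) (*-identityʳ (l * l))) ⟨
    (√5 * √5 * (f * f) * fromℚ 1ℚ + l * l * fromℚ 1ℚ) * √5f₂⁻¹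
      ≡⟨ cong₂ (λ x y → (√5 * √5 * (f * f) * x + l * l * y) * √5f₂⁻¹) l-inverse √5f-inverse ⟨
    -- With the units inserted, both summands contain the factor √5·f·l. It equals √5·f₂ and cancels
    -- against `√5f₂⁻¹`.
    (√5 * √5 * (f * f) * (l * l⁻¹) + l * l * (√5 * f * √5f⁻¹)) * √5f₂⁻¹
      ≡⟨ solve 6 (λ s f l a b d →
           (s :* s :* (f :* f) :* (l :* b) :+ l :* l :* (s :* f :* a)) :* d :=
           (s :* f :* b :+ l :* a) :* (s :* (f :* l) :* d)) refl √5 f l √5f⁻¹ l⁻¹ √5f₂⁻¹ ⟩
    (√5F/L + L/√5F) * (√5 * (f * l) * √5f₂⁻¹)
      ≡⟨ cong (λ x → (√5F/L + L/√5F) * (√5 * x * √5f₂⁻¹)) f₂≡f*l ⟨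
    (√5F/L + L/√5F) * (√5 * f₂ * √5f₂⁻¹)
      ≡⟨ cong ((√5F/L + L/√5F) *_) √5f₂-inverse ⟩
    (√5F/L + L/√5F) * fromℚ 1ℚ
      ≡⟨ *-identityʳ _ ⟩
    √5F/L + L/√5F ∎
    where open ≡.≡-Reasoning

theorem11 : (n : ℕ) .{{_ : ℕ.NonZero n}} (p : ℤ) .{{_ : ℤ.NonZero p}} →
    ∑[ k ≤ n ] ( (- fromℚ 1ℚ) ^ (n ∸ k)
                 * fromℚ (+ n ℚ./ (n ℕ.+ k))
                 * fromℕ ((n ℕ.+ k) C (n ∸ k))
                 * (((fromℕ 2 * fromℤ (L (+ 2 ℤ.* p))) ÷ (√5 * fromℤ (F (+ 2 ℤ.* p))))
                     {{√5F2-nonZero p}}) ^ (2 ℕ.* k) )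
    ≡ fromℚ ½ * ( (((√5 * fromℤ (F p)) ÷ fromℤ (L p)) {{L-nonZero p}}) ^ (2 ℕ.* n)
                 + ((fromℤ (L p) ÷ (√5 * fromℤ (F p))) {{√5F-nonZero p}}) ^ (2 ℕ.* n) )
-- Since `_÷_` unfolds to multiplication by the inverse, the right-hand side already is that of
-- `sum-u+v`; only the base on the left has to be rewritten as u + v.
theorem11 (suc m) p = trans
  (sum-cong-≋ {suc (suc m)} (λ i → cong (λ x →
    (- fromℚ 1ℚ) ^ (suc m ∸ toℕ i)
    * fromℚ (+ suc m ℚ./ (suc m ℕ.+ toℕ i))
    * fromℕ ((suc m ℕ.+ toℕ i) C (suc m ∸ toℕ i))
    * x ^ (2 ℕ.* toℕ i)) (2*L₂/√5F₂≡√5F/L+L/√5F p)))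
  (sum-u+v (√5F/L p) (L/√5F p) (√5F/L*L/√5F≡1 p) m)
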